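{- Let $a,b,c$ be positive integers with $c\ge 2$ and $\gcd(b,c)=1$. Let $\tilde{k}:=\min\{k\in\mathbb{N}: s_k(a)>c-1\}$. Then $S_{\tilde{k}-1}(a,b,c)$ is a minimal set of generators for $G_{a,b}(c)$.
   Context: $\mathbb{N}$ denotes the set of non-negative integers (including $0$). For positive integers $a,b$ let $\theta_{a,b}:\mathbb{N}\to\mathbb{N}$, $x\mapsto ax+b$. A subsemigroup $G$ of $(\mathbb{N},+)$ containing $0$ is called a $\theta_{a,b}$-semigroup if $\theta_{a,b}(y)\in G$ for every $y\in G\setminus\{0\}$. $G_{a,b}(c)$ denotes the smallest (with respect to inclusion) $\theta_{a,b}$-semigroup containing $c$. For $k\in\mathbb{N}$ set $s_0(a)=0$ and $s_k(a)=\sum_{i=0}^{k-1}a^i$ for $k\ge 1$, and $t_k(a,b,c)=a^kc+b\cdot s_k(a)$. For $m\in\mathbb{N}$ let $S_m(a,b,c)=\{t_k(a,b,c):k\in\mathbb{N},\ 0\le k\le m\}$. A set $S\subseteq\mathbb{N}$ generates $G$ if $G=\langle S\rangle$, the set of all finite linear combinations of elements of $S$ with coefficients in $\mathbb{N}$; a generating set is minimal if no proper subset of it generates $G$. -}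

module Defs where

open import Data.List.Base using (List; map; applyUpTo)
open import Data.List.Relation.Unary.All using (All)
open import Data.Nat.Base
open import Data.Nat.ListAction using (sum)
open import Data.Nat.Properties using (+-mono-≤; m^n>0; _<?_)
open import Data.Product.Base using (∃; _×_; _,_; proj₁; proj₂; uncurry)
open import Function.Base using (_∘_)
open import Level using (0ℓ)
open import Relation.Binary.PropositionalEquality.Core using (_≡_; _≢_)
open import Relation.Nullary using (¬_; yes; no; contradiction)
open import Relation.Unary using (Pred; Decidable; _∈_; _⊆_; _⊂_; _≐_)

θ : ℕ → ℕ → ℕ → ℕ
θ a b x = a * x + b

record IsθSemigroup (a b : ℕ) (G : Pred ℕ 0ℓ) : Set where
  field
    0∈       : 0 ∈ G
    +-closed : ∀ {x y} → x ∈ G → y ∈ G → x + y ∈ G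
    θ-closed : ∀ {y} → y ∈ G → y ≢ 0 → θ a b y ∈ G

-- G = G_{a,b}(c).  Being least determines G up to _≐_; existence is
-- Closure-isSmallest below.
record IsSmallestθSemigroup (a b c : ℕ) (G : Pred ℕ 0ℓ) : Set₁ where
  field
    isθSemigroup : IsθSemigroup a b G
    contains     : c ∈ G
    smallest     : ∀ (H : Pred ℕ 0ℓ) → IsθSemigroup a b H → c ∈ H → G ⊆ H

s : ℕ → ℕ → ℕ
s k a = sum (applyUpTo (a ^_) k)

t : ℕ → ℕ → ℕ → ℕ → ℕ
t k a b c = a ^ k * c + b * s k a

S : ℕ → ℕ → ℕ → ℕ → Pred ℕ 0ℓ
S m a b c x = ∃ λ k → k ≤ m × x ≡ t k a b c

-- A linear combination is a list of pairs (coefficient , element).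
⟨_⟩ : Pred ℕ 0ℓ → Pred ℕ 0ℓ
⟨ X ⟩ x = ∃ λ (ps : List (ℕ × ℕ)) →
  All ((_∈ X) ∘ proj₂) ps × x ≡ sum (map (uncurry _*_) ps)

Generates : Pred ℕ 0ℓ → Pred ℕ 0ℓ → Set
Generates X G = G ≐ ⟨ X ⟩

IsMinimalGeneratingSet : Pred ℕ 0ℓ → Pred ℕ 0ℓ → Set₁
IsMinimalGeneratingSet X G =
  Generates X G × (∀ (Y : Pred ℕ 0ℓ) → Y ⊂ X → ¬ Generates Y G)

IsMin : Pred ℕ 0ℓ → ℕ → Set
IsMin P k = k ∈ P × (∀ j → j ∈ P → k ≤ j)

data Closure (a b c : ℕ) : Pred ℕ 0ℓ where
  base : c ∈ Closure a b c
  zero : 0 ∈ Closure a b c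
  add  : ∀ {x y} → x ∈ Closure a b c → y ∈ Closure a b c → x + y ∈ Closure a b c
  step : ∀ {y} → y ∈ Closure a b c → y ≢ 0 → θ a b y ∈ Closure a b c

Closure-isSmallest : ∀ a b c → IsSmallestθSemigroup a b c (Closure a b c)
Closure-isSmallest a b c = record
  { isθSemigroup = record { 0∈ = zero ; +-closed = add ; θ-closed = step }
  ; contains     = base
  ; smallest     = least
  }
  where
  least : ∀ H → IsθSemigroup a b H → c ∈ H → Closure a b c ⊆ H
  least H isH c∈H = go
    where
    open IsθSemigroup isH
    go : Closure a b c ⊆ H
    go base         = c∈H
    go zero         = 0∈
    go (add p q)    = +-closed (go p) (go q)
    go (step p y≢0) = θ-closed (go p) y≢0

min-exists : ∀ {P : Pred ℕ 0ℓ} → Decidable P → ∀ n → n ∈ P → ∃ (IsMin P)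
min-exists P? zero    p = 0 , p , λ _ _ → z≤n
min-exists {P} P? (suc n) p with P? 0
... | yes p₀ = 0 , p₀ , λ _ _ → z≤n
... | no ¬p₀ with min-exists (P? ∘ suc) n p
...   | k , pk , k≤ = suc k , pk , bound
  where
  bound : ∀ j → j ∈ P → suc k ≤ j
  bound zero    p₀ = contradiction p₀ ¬p₀
  bound (suc j) pj = s≤s (k≤ j pj)

k≤s : ∀ a → .{{NonZero a}} → ∀ k → k ≤ s k a
k≤s a k = go (a ^_) (λ i → m^n>0 a i) k
  where
  go : ∀ (f : ℕ → ℕ) → (∀ i → 1 ≤ f i) → ∀ k → k ≤ sum (applyUpTo f k)
  go f 1≤f zero    = z≤n
  go f 1≤f (suc k) = +-mono-≤ (1≤f 0) (go (f ∘ suc) (1≤f ∘ suc) k)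

k̃-exists : ∀ a c → .{{NonZero a}} → ∃ (IsMin (λ k → s k a > c ∸ 1))
k̃-exists a c = min-exists (λ k → (c ∸ 1) <? s k a) (suc (c ∸ 1)) (k≤s a (suc (c ∸ 1)))

{-# OPTIONS --safe #-}
module Submission where

-- Put d = (a - 1) c + b.  Every orbit element of c has the closed form
-- t_k = c + d s_k, and d is coprime to c because b is (t-closed, coprime-d).
-- Write k̃ = m + 1, so that s_j < c for all j ≤ m while c ≤ s_{m+1}.
--
-- Generation.  Since t_{k+1} = θ(t_k), the set S_m lies in G, and ⟨ S_m ⟩ is
-- the whole of G as soon as it is closed under θ.  By ⟨⟩-isθSemigroup this
-- need only be checked on generators, where the only case in doubt is
-- θ(t_m) = t_{m+1}.  With p = s_{m+1} - c one has
--   t_{m+1} = c + d (c + p) = p t_1 + (1 + d - p) t_0,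
-- and p ≤ d follows from s_{m+1} = 1 + a s_m and s_m < c (overshoot≤).
-- The element t_1 is available because c ≥ 2 forces m ≥ 1.
--
-- Minimality.  Suppose Y ⊆ S_m generates G and write t_j (j ≤ m) as a
-- combination of elements of Y with N the sum of the coefficients.  By the
-- closed form, c + d s_j = N c + d U for some U; clearly N ≥ 1.  Coprimality
-- gives N - 1 = q d, hence s_j = q c + U, and s_j < c forces q = 0
-- (coefficientSum≡1).  So N = 1, which means that t_j itself is in Y.

open import Defs
open import Data.List.Base using ([]; _∷_; _++_; map; applyUpTo)
open import Data.List.Properties using (map-++)
open import Data.List.Relation.Unary.All as All using (All; []; _∷_)
open import Data.List.Relation.Unary.All.Properties using (++⁺)
open import Data.Nat.Base
  using (ℕ; zero; suc; _+_; _*_; _∸_; _^_; _≤_; _<_; _>_; z≤n; s≤s; NonZero; >-nonZero; >-nonZero⁻¹)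
open import Data.Nat.Coprimality
  using (Coprime; gcd≡1⇒coprime; coprime-divisor)
open import Data.Nat.Divisibility using (_∣_; divides; ∣m+n∣m⇒∣n; ∣n⇒∣m*n; m∣m*n)
open import Data.Nat.GCD using (gcd)
open import Data.Nat.ListAction using (sum)
open import Data.Nat.ListAction.Properties using (sum-++)
open import Data.Nat.Properties
open import Data.Nat.Tactic.RingSolver using (solve-∀)
open import Data.Product.Base using (∃; _,_; proj₁; proj₂; uncurry)
open import Function.Base using (_∘_)
open import Level using (0ℓ)
open import Relation.Binary.PropositionalEquality.Core
  using (_≡_; _≢_; refl; sym; trans; cong; cong₂; subst)
open import Relation.Binary.PropositionalEquality.Properties using (module ≡-Reasoning)
open import Relation.Nullary using (¬_; yes; no; contradiction)
open import Relation.Unary using (Pred; _∈_; _⊆_; _⊂_)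

-- Linear combinations and θ-semigroups

0∈⟨⟩ : ∀ {X} → 0 ∈ ⟨ X ⟩
0∈⟨⟩ = [] , [] , refl

⟨⟩-+ : ∀ {X x y} → x ∈ ⟨ X ⟩ → y ∈ ⟨ X ⟩ → x + y ∈ ⟨ X ⟩
⟨⟩-+ (ps , ps∈ , refl) (qs , qs∈ , refl) = ps ++ qs , ++⁺ ps∈ qs∈ ,
  sym (trans (cong sum (map-++ (uncurry _*_) ps qs)) (sum-++ (map (uncurry _*_) ps) _))

⊆⟨⟩ : ∀ {X} → X ⊆ ⟨ X ⟩
⊆⟨⟩ {x = x} x∈X = (1 , x) ∷ [] , x∈X ∷ [] ,
  sym (trans (+-identityʳ (1 * x)) (*-identityˡ x))

*-closed : ∀ (P : Pred ℕ 0ℓ) → 0 ∈ P → (∀ {x y} → x ∈ P → y ∈ P → x + y ∈ P) →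
  ∀ n {x} → x ∈ P → n * x ∈ P
*-closed P 0∈P +∈P zero    x∈P = 0∈P
*-closed P 0∈P +∈P (suc n) x∈P = +∈P x∈P (*-closed P 0∈P +∈P n x∈P)

⟨⟩-* : ∀ {X} n {x} → x ∈ ⟨ X ⟩ → n * x ∈ ⟨ X ⟩
⟨⟩-* {X} = *-closed ⟨ X ⟩ 0∈⟨⟩ ⟨⟩-+

⟨⟩⊆θSemigroup : ∀ {a b X G} → IsθSemigroup a b G → X ⊆ G → ⟨ X ⟩ ⊆ G
⟨⟩⊆θSemigroup {X = X} {G} isG X⊆G (ps , ps∈ , refl) = go ps ps∈
  where
  open IsθSemigroup isG
  go : ∀ ps → All ((_∈ X) ∘ proj₂) ps → sum (map (uncurry _*_) ps) ∈ G
  go []             []         = 0∈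
  go ((n , x) ∷ ps) (x∈ ∷ ps∈) =
    +-closed (*-closed G 0∈ +-closed n (X⊆G x∈)) (go ps ps∈)

-- Closure under θ may be checked on generators: if x is a generator, then
-- θ(x + y) = θ(x) + a y.
⟨⟩-isθSemigroup : ∀ {a b X} → (∀ {x} → x ∈ X → θ a b x ∈ ⟨ X ⟩) →
  IsθSemigroup a b ⟨ X ⟩
⟨⟩-isθSemigroup {a} {b} {X} θX = record
  { 0∈       = 0∈⟨⟩
  ; +-closed = ⟨⟩-+
  ; θ-closed = λ where (ps , ps∈ , refl) y≢0 → go ps ps∈ y≢0
  }
  where
  θ-+ : ∀ a b x y r → (a * x + b) + a * (y + r) ≡ a * (x + y + r) + b
  θ-+ = solve-∀

  go : ∀ ps → All ((_∈ X) ∘ proj₂) ps → sum (map (uncurry _*_) ps) ≢ 0 →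
    θ a b (sum (map (uncurry _*_) ps)) ∈ ⟨ X ⟩
  go []                 []         y≢0 = contradiction refl y≢0
  go ((zero  , x) ∷ ps) (x∈ ∷ ps∈) y≢0 = go ps ps∈ y≢0
  go ((suc n , x) ∷ ps) (x∈ ∷ ps∈) y≢0 =
    subst (_∈ ⟨ X ⟩) (θ-+ a b x (n * x) _)
      (⟨⟩-+ (θX x∈) (⟨⟩-* a (⟨⟩-+ (⟨⟩-* n (⊆⟨⟩ x∈)) (ps , ps∈ , refl))))

coefficientSum≡0 : ∀ ps → sum (map proj₁ ps) ≡ 0 → sum (map (uncurry _*_) ps) ≡ 0
coefficientSum≡0 []                eq = refl
coefficientSum≡0 ((zero , x) ∷ ps) eq = coefficientSum≡0 ps eq

coefficientSum≡1⇒∈ : ∀ {X : Pred ℕ 0ℓ} ps → All ((_∈ X) ∘ proj₂) ps →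
  sum (map proj₁ ps) ≡ 1 → sum (map (uncurry _*_) ps) ∈ X
coefficientSum≡1⇒∈     ((zero , x) ∷ ps)  (_ ∷ ps∈) eq = coefficientSum≡1⇒∈ ps ps∈ eq
coefficientSum≡1⇒∈ {X} ((suc n , x) ∷ ps) (x∈ ∷ _)  eq
  with refl ← m+n≡0⇒m≡0 n (suc-injective eq) = subst (_∈ X) x≡ x∈
  where
  open ≡-Reasoning
  x≡ : x ≡ x + 0 + sum (map (uncurry _*_) ps)
  x≡ = sym (begin
    x + 0 + sum (map (uncurry _*_) ps)
      ≡⟨ cong (x + 0 +_) (coefficientSum≡0 ps (suc-injective eq)) ⟩
    x + 0 + 0
      ≡⟨ trans (+-identityʳ (x + 0)) (+-identityʳ x) ⟩
    x ∎)

-- A combination of numbers congruent to c modulo d keeps track of its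
-- coefficient sum; the multiple of d is moreover non-negative.
combination-form : ∀ c d ps → All (λ p → ∃ λ u → proj₂ p ≡ c + d * u) ps →
  ∃ λ U → sum (map (uncurry _*_) ps) ≡ sum (map proj₁ ps) * c + d * U
combination-form c d []             []                 = 0 , sym (*-zeroʳ d)
combination-form c d ((n , _) ∷ ps) ((u , refl) ∷ ps≡) =
  let U , eq = combination-form c d ps ps≡ in
  n * u + U , trans (cong (n * (c + d * u) +_) eq) (regroup n c d u _ U)
  where
  regroup : ∀ n c d u N U →
    n * (c + d * u) + (N * c + d * U) ≡ (n + N) * c + d * (n * u + U)
  regroup = solve-∀

-- The sequences s and t

sum-applyUpTo-* : ∀ a f k →
  sum (applyUpTo (λ i → a * f i) k) ≡ a * sum (applyUpTo f k)
sum-applyUpTo-* a f zero    = sym (*-zeroʳ a)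
sum-applyUpTo-* a f (suc k) =
  trans (cong (a * f 0 +_) (sum-applyUpTo-* a (f ∘ suc) k))
        (sym (*-distribˡ-+ a (f 0) _))

s-suc : ∀ k a → s (suc k) a ≡ 1 + a * s k a
s-suc k a = cong suc (sum-applyUpTo-* a (a ^_) k)

-- The left-hand side is what t 0 a b c unfolds to, for every a.
t-zero : ∀ b c → 1 * c + b * 0 ≡ c
t-zero = solve-∀

t-suc : ∀ k a b c → t (suc k) a b c ≡ θ a b (t k a b c)
t-suc k a b c =
  trans (cong (λ z → a ^ suc k * c + b * z) (s-suc k a)) (expand a b c (a ^ k) (s k a))
  where
  expand : ∀ a b c x y → a * x * c + b * (1 + a * y) ≡ a * (x * c + b * y) + b
  expand = solve-∀

-- Here and below e stands for a - 1, and e * c + b for the number d.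
t-closed : ∀ k e b c → t k (suc e) b c ≡ c + (e * c + b) * s k (suc e)
t-closed zero    e b c = expand b c (e * c + b)
  where
  expand : ∀ b c d → 1 * c + b * 0 ≡ c + d * 0
  expand = solve-∀
t-closed (suc k) e b c = begin
  t (suc k) (suc e) b c
    ≡⟨ t-suc k (suc e) b c ⟩
  suc e * t k (suc e) b c + b
    ≡⟨ cong (λ z → suc e * z + b) (t-closed k e b c) ⟩
  suc e * (c + (e * c + b) * s k (suc e)) + b
    ≡⟨ expand e b c (s k (suc e)) ⟩
  c + (e * c + b) * (1 + suc e * s k (suc e))
    ≡⟨ cong (λ z → c + (e * c + b) * z) (s-suc k (suc e)) ⟨
  c + (e * c + b) * s (suc k) (suc e) ∎
  where
  open ≡-Reasoning
  expand : ∀ e b c y →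
    (1 + e) * (c + (e * c + b) * y) + b ≡ c + (e * c + b) * (1 + (1 + e) * y)
  expand = solve-∀

t≢0 : ∀ k e b {c} → 1 ≤ c → t k (suc e) b c ≢ 0
t≢0 k e b {c} 1≤c t≡0 =
  >⇒≢ 1≤c (m+n≡0⇒m≡0 c (trans (sym (t-closed k e b c)) t≡0))

-- Generation

t∈θSemigroup : ∀ {e b c G} → IsθSemigroup (suc e) b G → 1 ≤ c → c ∈ G →
  ∀ k → t k (suc e) b c ∈ G
t∈θSemigroup {e} {b} {c} {G} isG 1≤c c∈G zero = subst (_∈ G) (sym (t-zero b c)) c∈G
t∈θSemigroup {e} {b} {c} {G} isG 1≤c c∈G (suc k) =
  subst (_∈ G) (sym (t-suc k (suc e) b c))
    (IsθSemigroup.θ-closed isG (t∈θSemigroup isG 1≤c c∈G k) (t≢0 k e b 1≤c))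

-- The number p = s_{m+1} - c, used as the coefficient of t_1 below, is at most d.
overshoot≤ : ∀ e b c m → s m (suc e) < c → s (suc m) (suc e) ∸ c ≤ e * c + b
overshoot≤ e b c m sₘ<c = m≤n+o⇒m∸n≤o (s (suc m) (suc e)) c (begin
  s (suc m) (suc e)         ≡⟨ s-suc m (suc e) ⟩
  1 + (σ + e * σ)           ≤⟨ +-mono-≤ sₘ<c (*-monoʳ-≤ e (<⇒≤ sₘ<c)) ⟩
  c + e * c                 ≤⟨ +-monoʳ-≤ c (m≤m+n (e * c) b) ⟩
  c + (e * c + b)           ∎)
  where
  open ≤-Reasoning
  σ = s m (suc e)

t-suc∈⟨S⟩ : ∀ e b c m → 1 ≤ m → s m (suc e) < c → c ≤ s (suc m) (suc e) →
  t (suc m) (suc e) b c ∈ ⟨ S m (suc e) b c ⟩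
t-suc∈⟨S⟩ e b c m 1≤m sₘ<c c≤s = subst (_∈ ⟨ S m (suc e) b c ⟩) (sym decomposition)
  (⟨⟩-+ (⟨⟩-* p (⊆⟨⟩ (1 , 1≤m , refl))) (⟨⟩-* (1 + q) (⊆⟨⟩ (0 , z≤n , refl))))
  where
  open ≡-Reasoning
  d = e * c + b
  p = s (suc m) (suc e) ∸ c
  q = d ∸ p

  p+q≡d : p + q ≡ d
  p+q≡d = m+[n∸m]≡n (overshoot≤ e b c m sₘ<c)

  expand : ∀ c p q → c + (p + q) * (c + p) ≡
    p * (c + (p + q) * 1) + (1 + q) * (c + (p + q) * 0)
  expand = solve-∀

  decomposition : t (suc m) (suc e) b c ≡
    p * t 1 (suc e) b c + (1 + q) * t 0 (suc e) b c
  decomposition = begin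
    t (suc m) (suc e) b c
      ≡⟨ t-closed (suc m) e b c ⟩
    c + d * s (suc m) (suc e)
      ≡⟨ cong (λ z → c + d * z) (m+[n∸m]≡n c≤s) ⟨
    c + d * (c + p)
      ≡⟨ subst (λ z → c + z * (c + p) ≡ p * (c + z * 1) + (1 + q) * (c + z * 0))
           p+q≡d (expand c p q) ⟩
    p * (c + d * 1) + (1 + q) * (c + d * 0)
      ≡⟨ cong₂ (λ y z → p * y + (1 + q) * z) (t-closed 1 e b c) (t-closed 0 e b c) ⟨
    p * t 1 (suc e) b c + (1 + q) * t 0 (suc e) b c ∎

S-generates : ∀ {e b c G} m → 1 ≤ m → s m (suc e) < c → c ≤ s (suc m) (suc e) →
  IsSmallestθSemigroup (suc e) b c G → Generates (S m (suc e) b c) G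
S-generates {e} {b} {c} {G} m 1≤m sₘ<c c≤s isG =
  smallest ⟨ S m (suc e) b c ⟩ (⟨⟩-isθSemigroup θS) c∈⟨S⟩ ,
  ⟨⟩⊆θSemigroup isθSemigroup S⊆G
  where
  open IsSmallestθSemigroup isG

  θS : ∀ {x} → x ∈ S m (suc e) b c → θ (suc e) b x ∈ ⟨ S m (suc e) b c ⟩
  θS (k , k≤m , refl) = subst (_∈ ⟨ S m (suc e) b c ⟩) (t-suc k (suc e) b c) t-suc∈
    where
    t-suc∈ : t (suc k) (suc e) b c ∈ ⟨ S m (suc e) b c ⟩
    t-suc∈ with k ≟ m
    ... | yes refl = t-suc∈⟨S⟩ e b c m 1≤m sₘ<c c≤s
    ... | no  k≢m  = ⊆⟨⟩ (suc k , ≤∧≢⇒< k≤m k≢m , refl)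

  c∈⟨S⟩ : c ∈ ⟨ S m (suc e) b c ⟩
  c∈⟨S⟩ = ⊆⟨⟩ (0 , z≤n , sym (t-zero b c))

  S⊆G : S m (suc e) b c ⊆ G
  S⊆G (k , _ , refl) = t∈θSemigroup isθSemigroup (≤-trans (s≤s z≤n) sₘ<c) contains k

-- Minimality

coprime-d : ∀ e {b c} → gcd b c ≡ 1 → Coprime (e * c + b) c
coprime-d e {b} {c} gcd≡1 (i∣d , i∣c) =
  gcd≡1⇒coprime gcd≡1 (∣m+n∣m⇒∣n i∣d (∣n⇒∣m*n e i∣c) , i∣c)

-- For d coprime to c and σ < c, the number c + d σ has only one
-- representation N c + d U with N > 0, namely the one with N = 1.
coefficientSum≡1 : ∀ {c d σ} n U → .{{NonZero d}} → Coprime d c → σ < c →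
  c + d * σ ≡ suc n * c + d * U → suc n ≡ 1
coefficientSum≡1 {c} {d} {σ} n U coprime σ<c eq = cong suc (n≡0 d∣n)
  where
  dσ≡ : d * σ ≡ d * U + c * n
  dσ≡ = +-cancelˡ-≡ c _ _ (trans eq (regroup n c d U))
    where
    regroup : ∀ n c d U → (1 + n) * c + d * U ≡ c + (d * U + c * n)
    regroup = solve-∀

  d∣n = coprime-divisor coprime
    (∣m+n∣m⇒∣n (subst (d ∣_) dσ≡ (m∣m*n σ)) (m∣m*n U))

  n≡0 : d ∣ n → n ≡ 0
  n≡0 (divides zero    n≡)   = n≡
  n≡0 (divides (suc q) refl) = contradiction σ<c (≤⇒≯ c≤σ)
    where
    regroup : ∀ c d q U → d * U + c * ((1 + q) * d) ≡ d * (c + (q * c + U))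
    regroup = solve-∀
    c≤σ : c ≤ σ
    c≤σ = subst (c ≤_)
      (sym (*-cancelˡ-≡ σ _ d (trans dσ≡ (regroup c d q U))))
      (m≤m+n c _)

-- An element t_j with s_j < c is a combination of numbers t_k only when it is
-- one of them.
t∈generators : ∀ {e b c m} → .{{NonZero b}} → gcd b c ≡ 1 →
  ∀ {Y : Pred ℕ 0ℓ} → Y ⊆ S m (suc e) b c →
  ∀ j → s j (suc e) < c → t j (suc e) b c ∈ ⟨ Y ⟩ → t j (suc e) b c ∈ Y
t∈generators {e} {b} {c} gcd≡1 {Y} Y⊆S j sⱼ<c (ps , ps∈ , t≡) =
  subst (_∈ Y) (sym t≡) (coefficientSum≡1⇒∈ ps ps∈ (N≡1 (sum (map proj₁ ps)) refl))
  where
  d = e * c + b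

  instance
    d≢0 : NonZero d
    d≢0 = >-nonZero
      (≤-trans (>-nonZero⁻¹ b) (m≤n+m b (e * c)))

  form : ∃ λ U → sum (map (uncurry _*_) ps) ≡ sum (map proj₁ ps) * c + d * U
  form = combination-form c d ps
    (All.map (λ y∈Y → let k , _ , y≡ = Y⊆S y∈Y in
                s k (suc e) , trans y≡ (t-closed k e b c)) ps∈)

  N≡1 : ∀ N → sum (map proj₁ ps) ≡ N → sum (map proj₁ ps) ≡ 1
  N≡1 zero    N≡ = contradiction (trans t≡ (coefficientSum≡0 ps N≡))
                     (t≢0 j e b (≤-trans (s≤s z≤n) sⱼ<c))
  N≡1 (suc n) N≡ = trans N≡ (coefficientSum≡1 n (proj₁ form) (coprime-d e gcd≡1) sⱼ<c
    (trans (sym (t-closed j e b c)) (trans t≡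
      (subst (λ N → sum (map (uncurry _*_) ps) ≡ N * c + d * proj₁ form) N≡ (proj₂ form)))))

theorem3p2 : ∀ (a b c : ℕ) → .{{_ : NonZero a}} → .{{_ : NonZero b}} →
    2 ≤ c → gcd b c ≡ 1 →
    ∀ (k̃ : ℕ) → IsMin (λ k → s k a > c ∸ 1) k̃ →
    ∀ (G : Pred ℕ 0ℓ) → IsSmallestθSemigroup a b c G →
    IsMinimalGeneratingSet (S (k̃ ∸ 1) a b c) G
theorem3p2 (suc e) b (suc zero) (s≤s ())
-- For k̃ = 1 the condition on k̃ reads c - 1 < s_1 = 1, contrary to 2 ≤ c;
-- the case k̃ = 0 is immediately absurd, since s_0 = 0.
theorem3p2 (suc e) b (suc (suc c)) 2≤c gcd≡1 (suc zero) (s≤s () , _) G isG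
theorem3p2 (suc e) b (suc (suc c)) 2≤c gcd≡1 (suc (suc m)) (c<s , least) G isG =
  generates , minimal
  where
  X = S (suc m) (suc e) b (suc (suc c))

  s< : ∀ {j} → j ≤ suc m → s j (suc e) < suc (suc c)
  s< {j} j≤ = s≤s (≮⇒≥ λ c<sⱼ → <⇒≱ (least j c<sⱼ) j≤)

  generates : Generates X G
  generates = S-generates (suc m) (s≤s z≤n) (s< ≤-refl) c<s isG

  minimal : ∀ (Y : Pred ℕ 0ℓ) → Y ⊂ X → ¬ Generates Y G
  minimal Y (Y⊆X , X⊈Y) (G⊆⟨Y⟩ , _) = X⊈Y λ where
    x∈X@(j , j≤ , refl) →
      t∈generators gcd≡1 Y⊆X j (s< j≤) (G⊆⟨Y⟩ (proj₂ generates (⊆⟨⟩ x∈X)))
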